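{- Let $\lambda$ be a partition, $\pi$ a reverse plane partition of shape $\lambda$ and $u\in\mathrm{cand}(\pi)$ a candidate. Then there exists a factor $h\in\mathcal F(\pi)$ with $h\le h(u,\pi)$.
   Context: Cells are pairs $(i,j)\in\mathbb Z^2$; $\mathrm n(i,j)=(i-1,j)$, $\mathrm e(i,j)=(i,j+1)$, $\mathrm s(i,j)=(i+1,j)$, $\mathrm w(i,j)=(i,j-1)$. A partition $\lambda$ is identified with its Young diagram; $\lambda'$ is its conjugate. A reverse plane partition of shape $\lambda$ is $\pi:\lambda\to\mathbb N$ with $\pi(u)\le\pi(\mathrm e u),\pi(\mathrm s u)$, with conventions $\pi(i,j)=0$ if $i\le0$ or $j\le0$, $\pi(i,j)=\infty$ if $i,j\ge1$, $(i,j)\notin\lambda$. Content $c(i,j)=j-i$; outer corner: $u\in\lambda$, $\mathrm e u,\mathrm s u\notin\lambda$; inner corner: $\mathrm e u,\mathrm s u\in\lambda$, $\mathrm e\mathrm s u\notin\lambda$. With inner corner contents $i_1<\dots<i_r$ and outer corner contents $o_1<\dots<o_{r+1}$ (interlacing), $\mathcal I=\{u\in\lambda:c(u)=i_k\}$, $\mathcal O=\{u\in\lambda:c(u)=o_k\}$, $\mathcal A=\{u\in\lambda:c(u)<o_1\text{ or }i_k<c(u)<o_{k+1}\text{ for some }k\in[r]\}$, $\mathcal B=\{u\in\lambda:o_k<c(u)<i_k\text{ for some }k\in[r]\text{ or }c(u)>o_{r+1}\}$. Candidates: $\mathrm{cand}(\pi)=\{u\in\mathcal O:\pi(u)>\pi(\mathrm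 w u)\}\cup\{u\in\mathcal A:\pi(u)>\pi(\mathrm w u),\pi(u)>\pi(\mathrm n u)\}$. North-east path: $(u_0,\dots,u_s)$ in $\lambda$, $u_k\in\{\mathrm n u_{k-1},\mathrm e u_{k-1}\}$, length $s$, head $\alpha=u_0$, tail $\omega=u_s$. South-west path: $(v_0,\dots,v_s)$, $v_k\in\{\mathrm s v_{k-1},\mathrm w v_{k-1}\}$, length $s$, $\alpha=v_s$, $\omega=v_0$. Rim-hook: north-east path $h$ with $\mathrm s\alpha(h)\notin\lambda$, $\mathrm e\omega(h)\notin\lambda$, $\mathrm e\mathrm s u\notin\lambda$ for all $u\in h$; for $u=(i,j)\in\lambda$, $h^u$ is the rim-hook from $(\lambda'_j,j)$ to $(i,\lambda_i)$, and these are all rim-hooks. Reverse lexicographic order on cells: $(i,j)\le(k,l)$ iff $j>l$, or $j=l$ and $i\ge k$; rim-hooks are ordered by $h^u\le h^v$ iff $u\le v$. $(\pi-P)(u)=\pi(u)-1$ for $u\in P$, else $\pi(u)$. $(P,\pi)$ compatible: $u\in P\cap(\mathcal I\cup\mathcal A)$ implies $\mathrm e u\in P$ and $\pi(u)=\pi(\mathrm e u)$; $u,\mathrm s u\in P$ implies $\pi(u)=\pi(\mathrm s u)$. $h\in\mathcal F(\pi)$ (factor) if there is a south-west path $P$ with $\omega(P)=\omega(h)$, $\ell(P)=\ell(h)$, $(P,\pi)$ compatible and $\pi-P$ a reverse plane partition. For $v\in\mathrm{cand}(\pi)$, $Q(v,\pi)$ is the north-east path starting at $v$ which, from current cell $u$,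 moves to $\mathrm n u$ if $u\in\mathcal O\cup\mathcal B$ and $\pi(u)=\pi(\mathrm n u)$; to $\mathrm e u$ if $u\in\mathcal I\cup\mathcal A$, or if $\mathrm e u\in\lambda$ and $\pi(u)>\pi(\mathrm n u)$; and terminates if $\pi(u)>\pi(\mathrm n u)$ and $\mathrm e u\notin\lambda$. $h(v,\pi)$ is the rim-hook of $\lambda$ with $\omega(h(v,\pi))=\omega(Q(v,\pi))$ and $\ell(h(v,\pi))=\ell(Q(v,\pi))$. -}

module Defs where

open import Data.Nat using (ℕ; zero; suc; _≤_; _<_; _>_; _∸_; _+_; _≤?_)
import Data.Nat.Properties as ℕP
open import Data.Integer as ℤ using (ℤ; _⊖_)
import Data.Integer.Properties as ℤP
open import Data.List using (List; []; _∷_; length; map; concatMap; filter; upTo)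
open import Data.List.Membership.Propositional using (_∈_)
open import Data.List.Membership.DecPropositional using () renaming (_∈?_ to mem?)
open import Data.List.Relation.Unary.Linked using (Linked)
open import Data.Product using (Σ; ∃; _×_; _,_)
open import Data.Product.Properties using (≡-dec)
open import Data.Sum using (_⊎_)
open import Relation.Nullary using (¬_; Dec; yes; no)
open import Relation.Nullary.Decidable using (_×-dec_; ¬?)
open import Relation.Binary.PropositionalEquality using (_≡_)
import Data.List.Sort as Sort

-- A cell (i , j) ∈ ℕ × ℕ.  Cells of a Young diagram have i , j ≥ 1;
-- row 0 / column 0 is the "boundary" where π is conventionally 0.
Cell : Set
Cell = ℕ × ℕ

nC eC sC wC : Cell → Cell
nC (i , j) = (i ∸ 1 , j)
eC (i , j) = (i , suc j)
sC (i , j) = (suc i , j)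
wC (i , j) = (i , j ∸ 1)

-- A partition is a weakly decreasing list of row lengths
-- (trailing zeros are harmless: they contribute no cells).
IsPartition : List ℕ → Set
IsPartition λs = Linked (λ a b → b ≤ a) λs

at : List ℕ → ℕ → ℕ
at []       _       = 0
at (x ∷ xs) zero    = x
at (x ∷ xs) (suc k) = at xs k

-- λ_i (1-indexed row length); λ_0 is never used for cells
rowLen : List ℕ → ℕ → ℕ
rowLen λs i = at λs (i ∸ 1)

colLen : List ℕ → ℕ → ℕ
colLen λs j = length (filter (λ x → j ≤? x) λs)

_∈λ_ : Cell → List ℕ → Set
(i , j) ∈λ λs = (1 ≤ i) × (1 ≤ j) × (j ≤ rowLen λs i)

_∈λ?_ : (u : Cell) → (λs : List ℕ) → Dec (u ∈λ λs)
(i , j) ∈λ? λs = (1 ≤? i) ×-dec ((1 ≤? j) ×-dec (j ≤? rowLen λs i))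

cells : List ℕ → List Cell
cells λs = concatMap (λ i → map (λ j → (suc i , suc j)) (upTo (at λs i))) (upTo (length λs))

content : Cell → ℤ
content (i , j) = j ⊖ i

IsOuterCorner : List ℕ → Cell → Set
IsOuterCorner λs u = (u ∈λ λs) × ¬ (eC u ∈λ λs) × ¬ (sC u ∈λ λs)

IsInnerCorner : List ℕ → Cell → Set
IsInnerCorner λs u = (eC u ∈λ λs) × (sC u ∈λ λs) × ¬ (eC (sC u) ∈λ λs)

outerCorner? : (λs : List ℕ) → (u : Cell) → Dec (IsOuterCorner λs u)
outerCorner? λs u = (u ∈λ? λs) ×-dec (¬? (eC u ∈λ? λs) ×-dec ¬? (sC u ∈λ? λs))

innerCorner? : (λs : List ℕ) → (u : Cell) → Dec (IsInnerCorner λs u)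
innerCorner? λs u = (eC u ∈λ? λs) ×-dec ((sC u ∈λ? λs) ×-dec ¬? (eC (sC u) ∈λ? λs))

open Sort ℤP.≤-decTotalOrder using (sort)

-- o_1 < … < o_{r+1}  (as a sorted list, 0-indexed: o_k = atℤ outerContents (k-1))
outerContents : List ℕ → List ℤ
outerContents λs = sort (map content (filter (outerCorner? λs) (cells λs)))

innerContents : List ℕ → List ℤ
innerContents λs = sort (map content (filter (innerCorner? λs) (cells λs)))

atℤ : List ℤ → ℕ → ℤ
atℤ []       _       = ℤ.0ℤ
atℤ (x ∷ xs) zero    = x
atℤ (x ∷ xs) (suc k) = atℤ xs k

-- o_k and i_k, 1-indexed (k ≥ 1)
oo ii : List ℕ → ℕ → ℤ
oo λs k = atℤ (outerContents λs) (k ∸ 1)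
ii λs k = atℤ (innerContents λs) (k ∸ 1)

rr : List ℕ → ℕ
rr λs = length (innerContents λs)

inI inO inA inB : List ℕ → Cell → Set
inI λs u = (u ∈λ λs) × (content u ∈ innerContents λs)
inO λs u = (u ∈λ λs) × (content u ∈ outerContents λs)
inA λs u = (u ∈λ λs) ×
  ((content u ℤ.< oo λs 1) ⊎
   (Σ ℕ λ k → (1 ≤ k) × (k ≤ rr λs) × (ii λs k ℤ.< content u) × (content u ℤ.< oo λs (suc k))))
inB λs u = (u ∈λ λs) ×
  ((Σ ℕ λ k → (1 ≤ k) × (k ≤ rr λs) × (oo λs k ℤ.< content u) × (content u ℤ.< ii λs k)) ⊎
   (oo λs (suc (rr λs)) ℤ.< content u))

-- π : λ → ℕ is modelled as a function on all cells; only its values on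
-- cells of λ matter.  The conventions π(i,j) = ∞ outside λ (i,j ≥ 1) are
-- encoded by only imposing the inequalities when the neighbour is in λ.
IsRPP : List ℕ → (Cell → ℕ) → Set
IsRPP λs π = ∀ u → u ∈λ λs →
  (eC u ∈λ λs → π u ≤ π (eC u)) × (sC u ∈λ λs → π u ≤ π (sC u))

-- value with the convention π(i,j) = 0 for i ≤ 0 or j ≤ 0
-- (only applied to n u, w u for u ∈ λ, which are in λ or on the boundary)
val : (Cell → ℕ) → Cell → ℕ
val π (zero , _)        = 0
val π (suc i , zero)    = 0
val π (suc i , suc j)   = π (suc i , suc j)

IsCand : List ℕ → (Cell → ℕ) → Cell → Set
IsCand λs π u =
  (inO λs u × val π (wC u) < π u) ⊎
  (inA λs u × val π (wC u) < π u × val π (nC u) < π u)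

-- Rim-hooks, indexed by cells: h^u for u = (i , j) ∈ λ is the rim-hook
-- from (λ'_j , j) to (i , λ_i).

hookTail : List ℕ → Cell → Cell
hookTail λs (i , j) = (i , rowLen λs i)

hookHead : List ℕ → Cell → Cell
hookHead λs (i , j) = (colLen λs j , j)

-- length of the north-east path from (λ'_j , j) to (i , λ_i)
hookLen : List ℕ → Cell → ℕ
hookLen λs (i , j) = (rowLen λs i ∸ j) + (colLen λs j ∸ i)

_≤rl_ : Cell → Cell → Set
(i , j) ≤rl (k , l) = (l < j) ⊎ ((j ≡ l) × (k ≤ i))

-- South-west paths (v_0 , … , v_s) as lists  v_0 ∷ … ∷ v_s ;
-- ω(P) = v_0 (the head of the list), ℓ(P) = s = length − 1.

data SWPath (λs : List ℕ) : List Cell → Set where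
  single : ∀ {u} → u ∈λ λs → SWPath λs (u ∷ [])
  step   : ∀ {u v ps} → u ∈λ λs → (v ≡ sC u ⊎ v ≡ wC u) →
           SWPath λs (v ∷ ps) → SWPath λs (u ∷ v ∷ ps)

cellDec : (u v : Cell) → Dec (u ≡ v)
cellDec = ≡-dec ℕP._≟_ ℕP._≟_

minusP : List Cell → (Cell → ℕ) → Cell → ℕ
minusP P π u with mem? cellDec u P
... | yes _ = π u ∸ 1
... | no  _ = π u

-- "π − P is a reverse plane partition": values stay in ℕ (π(u) ≥ 1 on P)
-- and the monotonicity conditions hold.
MinusIsRPP : List ℕ → List Cell → (Cell → ℕ) → Set
MinusIsRPP λs P π = (∀ u → u ∈ P → 1 ≤ π u) × IsRPP λs (minusP P π)

Compatible : List ℕ → List Cell → (Cell → ℕ) → Set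
Compatible λs P π =
  (∀ u → u ∈ P → (inI λs u ⊎ inA λs u) → (eC u ∈ P) × (π u ≡ π (eC u))) ×
  (∀ u → u ∈ P → sC u ∈ P → π u ≡ π (sC u))

IsFactor : List ℕ → (Cell → ℕ) → Cell → Set
IsFactor λs π u = Σ Cell λ v₀ → Σ (List Cell) λ ps →
  SWPath λs (v₀ ∷ ps) × (v₀ ≡ hookTail λs u) × (length ps ≡ hookLen λs u) ×
  Compatible λs (v₀ ∷ ps) π × MinusIsRPP λs (v₀ ∷ ps) π

-- The path Q(v, π), described by its tail ω and length s:
-- QPath λ π u ω s  means: the north-east path generated by the rules
-- starting at the current cell u ends at ω after s further steps.

data QPath (λs : List ℕ) (π : Cell → ℕ) : Cell → Cell → ℕ → Set where
  stop   : ∀ {u} → u ∈λ λs → val π (nC u) < π u → ¬ (eC u ∈λ λs) →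
           QPath λs π u u 0
  north  : ∀ {u ω s} → u ∈λ λs → (inO λs u ⊎ inB λs u) → π u ≡ val π (nC u) →
           QPath λs π (nC u) ω s → QPath λs π u ω (suc s)
  eastIA : ∀ {u ω s} → u ∈λ λs → (inI λs u ⊎ inA λs u) →
           QPath λs π (eC u) ω s → QPath λs π u ω (suc s)
  eastGt : ∀ {u ω s} → u ∈λ λs → eC u ∈λ λs → val π (nC u) < π u →
           QPath λs π (eC u) ω s → QPath λs π u ω (suc s)

{-# OPTIONS --safe #-}
module Submission where

-- Call a diagonal east-leaving if the rim step after it goes east (contents in I ∪ A) and
-- east-entered if the rim step before it does (contents in O ∪ A).  Follow Q(v, π) keeping
-- π(n w y) < π(y) at the current cell y.  The reversal of Q(v, π) is compatible and can be
-- subtracted unless at some y on an east-leaving diagonal π(y) < π(e y) or π(n y) = π(y).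
-- Then x = e y, resp. x = n y, lies on an east-entered diagonal and π(w x) < π(x); moving north
-- from x along equal entries reaches a candidate whose content exceeds that of v.  The head of
-- a rim-hook moves to a later column as its content grows, so that candidate yields a smaller
-- rim-hook, and one concludes by induction on the content.

open import Defs
open import Data.Nat using (ℕ; zero; suc; _+_; _∸_; _≤_; _<_; z≤n; s≤s; _≤?_; _<?_)
import Data.Nat.Properties as ℕP
open import Data.Nat.Solver using (module +-*-Solver)
open import Data.Integer as ℤ using (ℤ; +_; _⊖_)
import Data.Integer.Properties as ℤP
open import Data.List using (List; []; _∷_; length; map; filter; upTo)
open import Data.List.Membership.DecPropositional using () renaming (_∈?_ to mem?)
open import Data.List.Membership.Propositional using (_∈_)
open import Data.List.Membership.Propositional.Properties using (∈-map⁺; ∈-map⁻; ∈-filter⁺; ∈-filter⁻; ∈-upTo⁺; ∈-concat⁺′)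
open import Data.List.Properties using (filter-accept; filter-reject)
open import Data.List.Relation.Binary.Permutation.Propositional using (↭-sym; ↭⇒↭ₛ)
open import Data.List.Relation.Binary.Permutation.Propositional.Properties using (∈-resp-↭)
import Data.List.Relation.Binary.Permutation.Setoid.Properties as PermSetoid
open import Data.List.Relation.Unary.All as All using (All; []; _∷_)
import Data.List.Relation.Unary.All.Properties as AllP
open import Data.List.Relation.Unary.AllPairs as AllPairs using (AllPairs; []; _∷_)
import Data.List.Relation.Unary.AllPairs.Properties as AllPairsP
open import Data.List.Relation.Unary.Any using (here; there)
open import Data.List.Relation.Unary.Any.Properties using (¬Any[])
open import Data.List.Relation.Unary.Linked using (Linked; []; [-]; _∷_)
open import Data.List.Relation.Unary.Sorted.TotalOrder.Properties using (Sorted⇒AllPairs)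
open import Data.List.Relation.Unary.Unique.Propositional using (Unique)
import Data.List.Relation.Unary.Unique.Propositional.Properties as UniqueP
import Data.List.Sort as Sort
open import Data.Product using (Σ; _×_; _,_; proj₁; proj₂)
open import Data.Sum as Sum using (_⊎_; inj₁; inj₂; [_,_]′)
open import Data.Empty using (⊥; ⊥-elim)
open import Function using (_∘_)
open import Relation.Binary.Definitions using (tri<; tri≈; tri>)
open import Relation.Binary.PropositionalEquality using (_≡_; _≢_; refl; sym; trans; cong; cong₂; subst; subst₂; setoid)
open import Relation.Nullary using (¬_; Dec; yes; no)
open import Relation.Unary using (Decidable)

open +-*-Solver using (solve; _:=_; _:+_)
open Sort ℤP.≤-decTotalOrder using (sort; sort-↭; sort-↗)

-- Integer order by successor steps

i<suc[i] : ∀ i → i ℤ.< ℤ.suc i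
i<suc[i] i = ℤP.suc[i]≤j⇒i<j ℤP.≤-refl

-- An inductive form of the order on ℤ, so that runs of consecutive contents can be followed upwards
-- from their lower end.
data _≤ₛ_ (a : ℤ) : ℤ → Set where
  ≤ₛ-refl : a ≤ₛ a
  ≤ₛ-suc  : ∀ {c} → a ≤ₛ c → a ≤ₛ ℤ.suc c

≤ₛ⇒≤ : ∀ {a c} → a ≤ₛ c → a ℤ.≤ c
≤ₛ⇒≤ ≤ₛ-refl    = ℤP.≤-refl
≤ₛ⇒≤ (≤ₛ-suc p) = ℤP.≤-trans (≤ₛ⇒≤ p) (ℤP.i≤suc[i] _)

≤ₛ-+ : ∀ a n → a ≤ₛ (+ n ℤ.+ a)
≤ₛ-+ a zero    = subst (a ≤ₛ_) (sym (ℤP.+-identityˡ a)) ≤ₛ-refl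
≤ₛ-+ a (suc n) = subst (a ≤ₛ_) (sym (ℤP.suc-+ n a)) (≤ₛ-suc (≤ₛ-+ a n))

≤⇒≤ₛ : ∀ {a c} → a ℤ.≤ c → a ≤ₛ c
≤⇒≤ₛ {a} {c} a≤c = subst (a ≤ₛ_) eq (≤ₛ-+ a ℤ.∣ c ℤ.- a ∣)
  where
  eq : + ℤ.∣ c ℤ.- a ∣ ℤ.+ a ≡ c
  eq = trans (cong (ℤ._+ a) (ℤP.0≤i⇒+∣i∣≡i (ℤP.i≤j⇒0≤j-i a≤c)))
      (trans (ℤP.+-assoc c (ℤ.- a) a)
      (trans (cong (λ x → c ℤ.+ x) (ℤP.+-inverseˡ a)) (ℤP.+-identityʳ c)))

-- Interlacing of the corner contents

head-least : ∀ {x xs c} → All (x ℤ.<_) xs → c ∈ x ∷ xs → x ℤ.≤ c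
head-least x<xs (here refl) = ℤP.≤-refl
head-least x<xs (there c∈)  = ℤP.<⇒≤ (All.lookup x<xs c∈)

∈-tail : ∀ {x xs c} → x ℤ.< c → c ∈ x ∷ xs → c ∈ xs
∈-tail x<c (here refl) = ⊥-elim (ℤP.<-irrefl refl x<c)
∈-tail x<c (there c∈)  = c∈

-- The index `k` counts from 1 as in `inA` and `inB`, while `atℤ` counts from 0. Hence
-- `atℤ is (k ∸ 1)` is the k-th inner content and `atℤ os k` the outer content number k + 1.
AIndex BIndex : List ℤ → List ℤ → ℤ → Set
AIndex os is c = Σ ℕ λ k → (1 ≤ k) × (k ≤ length is) × (atℤ is (k ∸ 1) ℤ.< c) × (c ℤ.< atℤ os k)
BIndex os is c = Σ ℕ λ k → (1 ≤ k) × (k ≤ length is) × (atℤ os (k ∸ 1) ℤ.< c) × (c ℤ.< atℤ is (k ∸ 1))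

-- Interlacing of the corner contents, and with it the meaning of the index conditions that
-- define 𝒜 and ℬ, only uses which kinds of contents can follow each other along the rim.
module Word
  (R I O A B : ℤ → Set)
  (I⇒R : ∀ {c} → I c → R c) (O⇒R : ∀ {c} → O c → R c) (A⇒R : ∀ {c} → A c → R c)
  (I∩O : ∀ {c} → I c → O c → ⊥) (A∩I : ∀ {c} → A c → I c → ⊥)
  (B∩O : ∀ {c} → B c → O c → ⊥)
  (after-A : ∀ {c} → A c → O (ℤ.suc c) ⊎ A (ℤ.suc c))
  (after-I : ∀ {c} → I c → O (ℤ.suc c) ⊎ A (ℤ.suc c))
  (after-O : ∀ {c} → O c → R (ℤ.suc c) → I (ℤ.suc c) ⊎ B (ℤ.suc c))
  (after-B : ∀ {c} → B c → R (ℤ.suc c) → I (ℤ.suc c) ⊎ B (ℤ.suc c))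
  (R-pred : ∀ {a c} → R a → a ℤ.≤ c → R (ℤ.suc c) → R c)
  (R-bounded : ∀ a → Σ ℤ λ d → (a ℤ.≤ d) × ¬ R d)
  where

  R-convex : ∀ {a b c} → R a → a ℤ.≤ b → b ℤ.≤ c → R c → R b
  R-convex {a} {b} Ra a≤b b≤c = go (≤⇒≤ₛ b≤c)
    where
    go : ∀ {c} → b ≤ₛ c → R c → R b
    go ≤ₛ-refl    Rc = Rc
    go (≤ₛ-suc p) Rc = go p (R-pred Ra (ℤP.≤-trans a≤b (≤ₛ⇒≤ p)) Rc)

  -- After a content of kind A only O or A can follow, so a run of kind A ends only at an outer
  -- content.
  run-A : ∀ {a d} → O a ⊎ A a → (∀ c → a ℤ.≤ c → c ℤ.≤ d → ¬ O c) → a ≤ₛ d → A d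
  run-A (inj₁ Oa) none ≤ₛ-refl = ⊥-elim (none _ ℤP.≤-refl ℤP.≤-refl Oa)
  run-A (inj₂ Aa) none ≤ₛ-refl = Aa
  run-A s none (≤ₛ-suc p)
    with after-A (run-A s (λ c a≤c c≤d → none c a≤c (ℤP.≤-trans c≤d (ℤP.i≤suc[i] _))) p)
  ... | inj₁ o = ⊥-elim (none _ (≤ₛ⇒≤ (≤ₛ-suc p)) ℤP.≤-refl o)
  ... | inj₂ x = x

  run-B : ∀ {o d} → O o → (∀ c → o ℤ.< c → c ℤ.≤ d → ¬ I c) → ℤ.suc o ≤ₛ d → R d → B d
  run-B Oo none ≤ₛ-refl Rd with after-O Oo Rd
  ... | inj₁ i = ⊥-elim (none _ (i<suc[i] _) ℤP.≤-refl i)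
  ... | inj₂ b = b
  run-B Oo none (≤ₛ-suc p) Rd
    with after-B (run-B Oo (λ c o<c c≤d → none c o<c (ℤP.≤-trans c≤d (ℤP.i≤suc[i] _))) p
                   (R-pred (O⇒R Oo) (ℤP.≤-trans (ℤP.i≤suc[i] _) (≤ₛ⇒≤ p)) Rd)) Rd
  ... | inj₁ i = ⊥-elim (none _ (ℤP.suc[i]≤j⇒i<j (≤ₛ⇒≤ (≤ₛ-suc p))) ℤP.≤-refl i)
  ... | inj₂ b = b

  -- Here `a` is where the unread part of the rim begins: `more` reads one outer and one inner
  -- content and restarts just after the latter. Nothing but `R` bounds the segment after the last
  -- outer content.
  data Interlaced : ℤ → List ℤ → List ℤ → Set where
    last : ∀ {a o} → a ℤ.≤ o → (∀ c → a ℤ.≤ c → c ℤ.< o → A c) →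
           (∀ c → o ℤ.< c → R c → B c) → Interlaced a (o ∷ []) []
    more : ∀ {a o os i is} → a ℤ.≤ o → (∀ c → a ℤ.≤ c → c ℤ.< o → A c) →
           o ℤ.< i → (∀ c → o ℤ.< c → c ℤ.< i → B c) →
           Interlaced (ℤ.suc i) os is → Interlaced a (o ∷ os) (i ∷ is)

  -- A run of A can stop only at an outer content and a run of B between contents of the rim only at
  -- an inner one, so the two sorted lists are consumed alternately.
  interlace : ∀ {a} os is → O a ⊎ A a →
    AllPairs ℤ._<_ os → AllPairs ℤ._<_ is →
    All (a ℤ.≤_) os → All (a ℤ.≤_) is → All O os → All I is →
    (∀ c → a ℤ.≤ c → O c → c ∈ os) → (∀ c → a ℤ.≤ c → I c → c ∈ is) →
    Interlaced a os is
  -- With no outer content ahead, all contents from `a` on would be of kind A and hence on the rim,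
  -- which is bounded.
  interlace {a} [] is s _ _ _ _ _ _ O⇒∈ _ =
    let d , a≤d , ¬Rd = R-bounded a in
    ⊥-elim (¬Rd (A⇒R (run-A s (λ c a≤c _ Oc → ¬Any[] (O⇒∈ c a≤c Oc)) (≤⇒≤ₛ a≤d))))
  interlace {a} (o ∷ os) is s (o<os ∷ <os) <is (a≤o ∷ _) a≤is (Oo ∷ Oos) Iis O⇒∈ I⇒∈ = rest is <is a≤is Iis I⇒∈
    where
    A-before : ∀ c → a ℤ.≤ c → c ℤ.< o → A c
    A-before c a≤c c<o = run-A s (λ c′ a≤c′ c′≤c Oc′ →
      ℤP.≤⇒≯ (head-least o<os (O⇒∈ c′ a≤c′ Oc′)) (ℤP.≤-<-trans c′≤c c<o)) (≤⇒≤ₛ a≤c)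

    rest : ∀ is → AllPairs ℤ._<_ is → All (a ℤ.≤_) is → All I is →
      (∀ c → a ℤ.≤ c → I c → c ∈ is) → Interlaced a (o ∷ os) is
    rest [] _ _ _ I⇒∈ = ends os Oos o<os
      where
      B-after : ∀ c → o ℤ.< c → R c → B c
      B-after c o<c Rc = run-B Oo (λ c′ o<c′ _ Ic′ → ¬Any[] (I⇒∈ c′ (ℤP.<⇒≤ (ℤP.≤-<-trans a≤o o<c′)) Ic′))
                           (≤⇒≤ₛ (ℤP.i<j⇒suc[i]≤j o<c)) Rc
      ends : ∀ os → All O os → All (o ℤ.<_) os → Interlaced a (o ∷ os) []
      ends [] _ _ = last a≤o A-before B-after
      -- With no inner content left, everything on the rim past `o` is of kind B, so a second outer
      -- content cannot occur.
      ends (o′ ∷ _) (Oo′ ∷ _) (o<o′ ∷ _) = ⊥-elim (B∩O (B-after o′ o<o′ (O⇒R Oo′)) Oo′)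
    rest (i ∷ is) (i<is ∷ <is) (a≤i ∷ _) (Ii ∷ Iis) I⇒∈ =
      more a≤o A-before o<i B-between
        (interlace os is (after-I Ii) <os <is
          (All.zipWith (λ { {c} (o<c , Oc) → beyond c o<c Oc }) (o<os , Oos))
          (All.map ℤP.i<j⇒suc[i]≤j i<is) Oos Iis
          (λ c i<c Oc → ∈-tail (ℤP.<-trans o<i (ℤP.suc[i]≤j⇒i<j i<c))
            (O⇒∈ c (ℤP.<⇒≤ (ℤP.≤-<-trans a≤i (ℤP.suc[i]≤j⇒i<j i<c))) Oc))
          (λ c i<c Ic → ∈-tail (ℤP.suc[i]≤j⇒i<j i<c)
            (I⇒∈ c (ℤP.<⇒≤ (ℤP.≤-<-trans a≤i (ℤP.suc[i]≤j⇒i<j i<c))) Ic)))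
      where
      o<i : o ℤ.< i
      o<i with ℤP.<-cmp o i
      ... | tri< o<i _ _ = o<i
      ... | tri≈ _ refl _ = ⊥-elim (I∩O Ii Oo)
      ... | tri> _ _ i<o = ⊥-elim (A∩I (A-before i a≤i i<o) Ii)

      B-between : ∀ c → o ℤ.< c → c ℤ.< i → B c
      B-between c o<c c<i = run-B Oo
        (λ c′ o<c′ c′≤c Ic′ → ℤP.≤⇒≯ (head-least i<is (I⇒∈ c′ (ℤP.<⇒≤ (ℤP.≤-<-trans a≤o o<c′)) Ic′))
                                (ℤP.≤-<-trans c′≤c c<i))
        (≤⇒≤ₛ (ℤP.i<j⇒suc[i]≤j o<c)) (R-convex (O⇒R Oo) (ℤP.<⇒≤ o<c) (ℤP.<⇒≤ c<i) (I⇒R Ii))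

      beyond : ∀ c → o ℤ.< c → O c → ℤ.suc i ℤ.≤ c
      beyond c o<c Oc with ℤP.<-cmp i c
      ... | tri< i<c _ _ = ℤP.i<j⇒suc[i]≤j i<c
      ... | tri≈ _ refl _ = ⊥-elim (I∩O Ii Oc)
      ... | tri> _ _ c<i = ⊥-elim (B∩O (B-between c o<c c<i) Oc)

  A-first : ∀ {a os is c} → Interlaced a os is → a ℤ.≤ c → c ℤ.< atℤ os 0 → A c
  A-first (last _ A< _)     = A< _
  A-first (more _ A< _ _ _) = A< _

  A-index : ∀ {a os is c} → Interlaced a os is → AIndex os is c → A c
  A-index (last _ _ _) (suc _ , _ , () , _)
  A-index (more _ _ _ _ p) (1 , _ , _ , i<c , c<o) = A-first p (ℤP.i<j⇒suc[i]≤j i<c) c<o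
  A-index (more _ _ _ _ p) (suc (suc k) , _ , s≤s k≤ , i<c , c<o) = A-index p (suc k , s≤s z≤n , k≤ , i<c , c<o)

  B-index : ∀ {a os is c} → Interlaced a os is → BIndex os is c → B c
  B-index (last _ _ _) (suc _ , _ , () , _)
  B-index (more _ _ _ B< _) (1 , _ , _ , o<c , c<i) = B< _ o<c c<i
  B-index (more _ _ _ _ p) (suc (suc k) , _ , s≤s k≤ , o<c , c<i) = B-index p (suc k , s≤s z≤n , k≤ , o<c , c<i)

  B-last : ∀ {a os is c} → Interlaced a os is → R c → atℤ os (length is) ℤ.< c → B c
  B-last (last _ _ B>) Rc o<c = B> _ o<c Rc
  B-last (more _ _ _ _ p) = B-last p

  Covered : List ℤ → List ℤ → ℤ → Set
  Covered os is c = c ∈ is ⊎ c ∈ os ⊎ (c ℤ.< atℤ os 0 ⊎ AIndex os is c) ⊎ (BIndex os is c ⊎ atℤ os (length is) ℤ.< c)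

  cover : ∀ {a os is} c → Interlaced a os is → a ℤ.≤ c → Covered os is c
  cover c (last {o = o} _ _ _) a≤c with ℤP.<-cmp c o
  ... | tri< c<o _ _ = inj₂ (inj₂ (inj₁ (inj₁ c<o)))
  ... | tri≈ _ refl _ = inj₂ (inj₁ (here refl))
  ... | tri> _ _ o<c = inj₂ (inj₂ (inj₂ (inj₂ o<c)))
  cover c (more {o = o} {os} {i} {is} _ _ _ _ p) a≤c with ℤP.<-cmp c o
  ... | tri< c<o _ _ = inj₂ (inj₂ (inj₁ (inj₁ c<o)))
  ... | tri≈ _ refl _ = inj₂ (inj₁ (here refl))
  ... | tri> _ _ o<c with ℤP.<-cmp c i
  ...   | tri< c<i _ _ = inj₂ (inj₂ (inj₂ (inj₁ (1 , s≤s z≤n , s≤s z≤n , o<c , c<i))))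
  ...   | tri≈ _ refl _ = inj₁ (here refl)
  ...   | tri> _ _ i<c = shift (cover c p (ℤP.i<j⇒suc[i]≤j i<c))
    where
    shift : Covered os is c → Covered (o ∷ os) (i ∷ is) c
    shift (inj₁ c∈) = inj₁ (there c∈)
    shift (inj₂ (inj₁ c∈)) = inj₂ (inj₁ (there c∈))
    -- Lying before the first outer content of the tail now means lying between `i` and that
    -- content, which is index 1 of the longer lists.
    shift (inj₂ (inj₂ (inj₁ (inj₁ c<o)))) = inj₂ (inj₂ (inj₁ (inj₂ (1 , s≤s z≤n , s≤s z≤n , i<c , c<o))))
    shift (inj₂ (inj₂ (inj₁ (inj₂ (suc k , _ , q , r))))) = inj₂ (inj₂ (inj₁ (inj₂ (suc (suc k) , s≤s z≤n , s≤s q , r))))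
    shift (inj₂ (inj₂ (inj₂ (inj₁ (suc k , _ , q , r))))) = inj₂ (inj₂ (inj₂ (inj₁ (suc (suc k) , s≤s z≤n , s≤s q , r))))
    shift (inj₂ (inj₂ (inj₂ (inj₂ o<c)))) = inj₂ (inj₂ (inj₂ (inj₂ o<c)))

-- Contents compared through natural numbers

⊖-+ : ∀ j i k → (j ⊖ i) ℤ.+ + (i + k) ≡ + (j + k)
⊖-+ j i k = trans (ℤP.distribˡ-⊖-+-pos (i + k) j i)
  (trans (cong₂ _⊖_ eq (sym (ℕP.+-identityʳ i))) (ℤP.+-cancelˡ-⊖ i (j + k) 0))
  where
  eq : j + (i + k) ≡ i + (j + k)
  eq = trans (sym (ℕP.+-assoc j i k)) (trans (cong (_+ k) (ℕP.+-comm j i)) (ℕP.+-assoc i j k))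

⊖-+′ : ∀ l k i → (l ⊖ k) ℤ.+ + (i + k) ≡ + (l + i)
⊖-+′ l k i = trans (cong (λ x → (l ⊖ k) ℤ.+ + x) (ℕP.+-comm i k)) (⊖-+ l k i)

content-≡⇒ : ∀ u v → content u ≡ content v → proj₂ u + proj₁ v ≡ proj₂ v + proj₁ u
content-≡⇒ (i , j) (k , l) eq = ℤP.+-injective
  (trans (sym (⊖-+ j i k)) (trans (cong (ℤ._+ + (i + k)) eq) (⊖-+′ l k i)))

content-<⇒ : ∀ u v → content u ℤ.< content v → proj₂ u + proj₁ v < proj₂ v + proj₁ u
content-<⇒ (i , j) (k , l) lt = ℤP.drop‿+<+
  (subst₂ ℤ._<_ (⊖-+ j i k) (⊖-+′ l k i) (ℤP.+-monoˡ-< (+ (i + k)) lt))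

suc-injective : ∀ {a b} → ℤ.suc a ≡ ℤ.suc b → a ≡ b
suc-injective {a} {b} eq = trans (sym (ℤP.pred-suc a)) (trans (cong ℤ.pred eq) (ℤP.pred-suc b))

content-e : ∀ u → content (eC u) ≡ ℤ.suc (content u)
content-e (i , j) = sym (ℤP.distribʳ-⊖-+-pos 1 j i)

content-n : ∀ u → 1 ≤ proj₁ u → content (nC u) ≡ ℤ.suc (content u)
content-n (suc i , j) _ = sym (trans (ℤP.distribʳ-⊖-+-pos 1 j (suc i)) (ℤP.[1+m]⊖[1+n]≡m⊖n j i))

-- Row and column lengths of a partition

at-anti : ∀ {xs} → Linked (λ a b → b ≤ a) xs → ∀ {i k} → i ≤ k → at xs k ≤ at xs i
at-anti {[]}         _       _               = z≤n
at-anti {_ ∷ _}      _       {zero} {zero} _ = ℕP.≤-refl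
at-anti {_ ∷ []}     _       {zero} {suc _} _ = z≤n
at-anti {_ ∷ _ ∷ _}  (p ∷ l) {zero} {suc k} _ = ℕP.≤-trans (at-anti l {zero} {k} z≤n) p
at-anti {_ ∷ []}     _       (s≤s _)         = z≤n
at-anti {_ ∷ _ ∷ _}  (p ∷ l) (s≤s i≤k)       = at-anti l i≤k

Linked-tail : ∀ {x xs} → Linked (λ a b → b ≤ a) (x ∷ xs) → Linked (λ a b → b ≤ a) xs
Linked-tail [-]     = []
Linked-tail (_ ∷ l) = l

colLen-accept : ∀ {x j} xs → j ≤ x → colLen (x ∷ xs) j ≡ suc (colLen xs j)
colLen-accept {x} {j} xs j≤x = cong length (filter-accept (j ≤?_) {x} {xs} j≤x)

colLen-reject : ∀ {x j} xs → ¬ (j ≤ x) → colLen (x ∷ xs) j ≡ colLen xs j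
colLen-reject {x} {j} xs j≰x = cong length (filter-reject (j ≤?_) {x} {xs} j≰x)

-- Since rows weakly decrease, those of length at least `j` form an initial segment, and `colLen`
-- counts it. With `<colLen⇒≤at` this is the duality between a partition and its conjugate.
≤at⇒<colLen : ∀ {xs i j} → Linked (λ a b → b ≤ a) xs → 1 ≤ j → j ≤ at xs i → i < colLen xs j
≤at⇒<colLen {[]} _ 1≤j j≤0 = ⊥-elim (ℕP.<⇒≱ 1≤j j≤0)
≤at⇒<colLen {x ∷ xs} {zero} {j} l 1≤j j≤ = subst (0 <_) (sym (colLen-accept xs j≤)) (s≤s z≤n)
≤at⇒<colLen {x ∷ xs} {suc i} {j} l 1≤j j≤ =
  subst (suc i <_) (sym (colLen-accept xs (ℕP.≤-trans j≤ (at-anti l {zero} {suc i} z≤n))))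
    (s≤s (≤at⇒<colLen (Linked-tail l) 1≤j j≤))

<colLen⇒≤at : ∀ {xs i j} → Linked (λ a b → b ≤ a) xs → i < colLen xs j → j ≤ at xs i
<colLen⇒≤at {x ∷ xs} {i} {j} l i< = go i (j ≤? x) i<
  where
  go : ∀ i → Dec (j ≤ x) → i < colLen (x ∷ xs) j → j ≤ at (x ∷ xs) i
  go zero    (yes j≤x) _  = j≤x
  go (suc i) (yes j≤x) i< = <colLen⇒≤at (Linked-tail l) (ℕP.≤-pred (subst (suc i <_) (colLen-accept xs j≤x) i<))
  go i       (no j≰x)  i< = ⊥-elim (j≰x (ℕP.≤-trans
    (<colLen⇒≤at (Linked-tail l) (subst (i <_) (colLen-reject xs j≰x) i<)) (at-anti l {zero} {suc i} z≤n)))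

≤at⇒<length : ∀ xs {i j} → 1 ≤ j → j ≤ at xs i → i < length xs
≤at⇒<length []       1≤j j≤0          = ⊥-elim (ℕP.<⇒≱ 1≤j j≤0)
≤at⇒<length (x ∷ xs) {zero}  1≤j j≤ = s≤s z≤n
≤at⇒<length (x ∷ xs) {suc i} 1≤j j≤ = s≤s (≤at⇒<length xs 1≤j j≤)

-- Enumerated cells and sorted contents

∈λ⇒∈cells : ∀ λs u → u ∈λ λs → u ∈ cells λs
∈λ⇒∈cells λs (suc i , suc j) (_ , _ , j≤) = ∈-concat⁺′
  (∈-map⁺ (λ j → (suc i , suc j)) (∈-upTo⁺ j≤))
  (∈-map⁺ (λ i → map (λ j → (suc i , suc j)) (upTo (at λs i))) (∈-upTo⁺ (≤at⇒<length λs (s≤s z≤n) j≤)))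

cells-unique : ∀ λs → Unique (cells λs)
cells-unique λs = UniqueP.concat⁺
  (AllP.map⁺ (All.tabulate (λ {i} _ → UniqueP.map⁺ (λ { refl → refl }) (UniqueP.upTo⁺ (at λs i)))))
  (AllPairsP.map⁺ (AllPairs.map disjoint (UniqueP.upTo⁺ (length λs))))
  where
  disjoint : ∀ {i k} → i ≢ k → ∀ {u} →
    ¬ (u ∈ map (λ j → (suc i , suc j)) (upTo (at λs i)) × u ∈ map (λ j → (suc k , suc j)) (upTo (at λs k)))
  disjoint i≢k (p , q) with ∈-map⁻ _ p | ∈-map⁻ _ q
  ... | _ , _ , refl | _ , _ , refl = i≢k refl

module Contents (λs : List ℕ) {P : Cell → Set} (P? : Decidable P) where

  contents : List ℤ
  contents = sort (map content (filter P? (cells λs)))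

  ∈contents⁻ : ∀ {c} → c ∈ contents → Σ Cell λ u → P u × content u ≡ c
  ∈contents⁻ c∈ with ∈-map⁻ content (∈-resp-↭ (sort-↭ _) c∈)
  ... | u , u∈ , refl = u , proj₂ (∈-filter⁻ P? {xs = cells λs} u∈) , refl

  ∈contents⁺ : ∀ {u} → u ∈λ λs → P u → content u ∈ contents
  ∈contents⁺ {u} u∈λ Pu = ∈-resp-↭ (↭-sym (sort-↭ _))
    (∈-map⁺ content (∈-filter⁺ P? (∈λ⇒∈cells λs u u∈λ) Pu))

  -- Sorting alone gives a weak order. Strictness comes from every cell being listed once and each
  -- cell satisfying `P` being determined by its content.
  contents-sorted : (∀ {u v} → P u → P v → content u ≡ content v → u ≡ v) → AllPairs ℤ._<_ contents
  contents-sorted inj = AllPairs.zipWith (λ { (a≤b , a≢b) → ℤP.≤∧≢⇒< a≤b a≢b })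
    ( Sorted⇒AllPairs ℤP.≤-totalOrder (sort-↗ _)
    , PermSetoid.Unique-resp-↭ (setoid ℤ) (↭⇒↭ₛ (↭-sym (sort-↭ _)))
        (AllPairsP.map⁺ (injective-on (AllP.all-filter P? (cells λs))
          (AllPairsP.filter⁺ P? (cells-unique λs)))))
    where
    injective-on : ∀ {us} → All P us → Unique us → AllPairs (λ u v → content u ≢ content v) us
    injective-on []        []       = []
    injective-on (Pu ∷ Ps) (u≢ ∷ p) =
      All.zipWith (λ { (Pv , u≢v) eq → u≢v (inj Pu Pv eq) }) (Ps , u≢) ∷ injective-on Ps p

-- The rim of the diagram

module Rim (λs : List ℕ) (part : IsPartition λs) where

  ∈λ-down : ∀ {i j k l} → (k , l) ∈λ λs → 1 ≤ i → i ≤ k → 1 ≤ j → j ≤ l → (i , j) ∈λ λs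
  ∈λ-down (_ , _ , l≤) 1≤i i≤k 1≤j j≤l =
    1≤i , 1≤j , ℕP.≤-trans j≤l (ℕP.≤-trans l≤ (at-anti part (ℕP.∸-monoˡ-≤ 1 i≤k)))

  ∈λ⇒≤colLen : ∀ {i j} → (i , j) ∈λ λs → i ≤ colLen λs j
  ∈λ⇒≤colLen {suc i} (_ , 1≤j , j≤) = ≤at⇒<colLen part 1≤j j≤

  ≤colLen⇒∈λ : ∀ {i j} → 1 ≤ i → 1 ≤ j → i ≤ colLen λs j → (i , j) ∈λ λs
  ≤colLen⇒∈λ {suc i} 1≤i 1≤j i≤ = 1≤i , 1≤j , <colLen⇒≤at part i≤

  IsRim : Cell → Set
  IsRim r = (r ∈λ λs) × ¬ (eC (sC r) ∈λ λs)

  -- A cell further down the same diagonal would force the south-east neighbour of `r` into λ. So a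
  -- rim cell is the last cell of its diagonal.
  rim-dominates : ∀ {r u} → IsRim r → u ∈λ λs → content u ≡ content r → (proj₁ u ≤ proj₁ r) × (proj₂ u ≤ proj₂ r)
  rim-dominates {k , l} {i , j} (_ , ¬es) u∈ eq with i ≤? k
  ... | yes i≤k = i≤k , ℕP.+-cancelʳ-≤ k j l (subst (_≤ l + k) (sym (content-≡⇒ (i , j) (k , l) eq)) (ℕP.+-monoʳ-≤ l i≤k))
  ... | no i≰k = ⊥-elim (¬es (∈λ-down u∈ (s≤s z≤n) k<i (s≤s z≤n)
      (ℕP.+-cancelʳ-≤ k (suc l) j (subst₂ _≤_ (ℕP.+-suc l k) (sym (content-≡⇒ (i , j) (k , l) eq)) (ℕP.+-monoʳ-≤ l k<i)))))
    where
    k<i : k < i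
    k<i = ℕP.≰⇒> i≰k

  rim-unique : ∀ {r r′} → IsRim r → IsRim r′ → content r ≡ content r′ → r ≡ r′
  rim-unique R R′ eq =
    let i≤ , j≤ = rim-dominates R′ (proj₁ R) eq
        i≥ , j≥ = rim-dominates R (proj₁ R′) (sym eq)
    in cong₂ _,_ (ℕP.≤-antisym i≤ i≥) (ℕP.≤-antisym j≤ j≥)

  rim-exists : ∀ {u} → u ∈λ λs → Σ Cell λ r → IsRim r × content r ≡ content u
  rim-exists {u} u∈ = go (rowLen λs 1) u u∈ (ℕP.m≤m+n _ _)
    where
    -- Slide south-east along the diagonal; `n` bounds the columns still available within the first
    -- row.
    go : ∀ n u → u ∈λ λs → rowLen λs 1 ≤ n + proj₂ u → Σ Cell λ r → IsRim r × content r ≡ content u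
    go n u u∈ _ with eC (sC u) ∈λ? λs
    go n       u u∈ _ | no ¬es = u , (u∈ , ¬es) , refl
    go zero    (i , j) u∈ b | yes es =
      ⊥-elim (ℕP.<⇒≱ (proj₂ (proj₂ (∈λ-down es (s≤s z≤n) (s≤s z≤n) (s≤s z≤n) ℕP.≤-refl))) b)
    go (suc n) (i , j) u∈ b | yes es =
      let r , R , eq = go n (suc i , suc j) es (subst (rowLen λs 1 ≤_) (sym (ℕP.+-suc n j)) b)
      in r , R , trans eq (ℤP.[1+m]⊖[1+n]≡m⊖n j i)

  OnRim : (Cell → Set) → ℤ → Set
  OnRim P c = Σ Cell λ r → IsRim r × content r ≡ c × P r

  onRim-unique : ∀ {P Q : Cell → Set} {c} {X : Set} → (∀ {r} → P r → Q r → X) → OnRim P c → OnRim Q c → X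
  onRim-unique f (r , R , eq , p) (r′ , R′ , eq′ , q) with rim-unique R R′ (trans eq (sym eq′))
  ... | refl = f p q

  onRim-map : ∀ {P Q : Cell → Set} {c} → (∀ {r} → P r → Q r) → OnRim P c → OnRim Q c
  onRim-map f (r , rim , eq , p) = r , rim , eq , f p

  E∈ S∈ : Cell → Set
  E∈ r = eC r ∈λ λs
  S∈ r = sC r ∈λ λs

  -- The kind of a content is read off the rim cell carrying it. The rim goes on to the east when
  -- that cell has an east neighbour and to the north otherwise; the interlacing ties this to the
  -- index definitions of `inA` and `inB`.
  R I O A B : ℤ → Set
  R c = Σ Cell λ r → IsRim r × content r ≡ c
  I = OnRim (λ r → E∈ r × S∈ r)
  O = OnRim (λ r → ¬ E∈ r × ¬ S∈ r)
  A = OnRim (λ r → E∈ r × ¬ S∈ r)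
  B = OnRim (λ r → ¬ E∈ r × S∈ r)

  onRim⇒R : ∀ {P c} → OnRim P c → R c
  onRim⇒R (r , rim , eq , _) = r , rim , eq

  -- The missing south-east neighbour of `r` is the south neighbour of `eC r`, so `eC r` is the next
  -- rim cell and has nothing below it.
  after-east : ∀ {c} → OnRim E∈ c → O (ℤ.suc c) ⊎ A (ℤ.suc c)
  after-east (r , (_ , ¬es) , refl , e∈) = found (eC (eC r) ∈λ? λs)
    where
    e-rim : IsRim (eC r)
    e-rim = e∈ , λ p → ¬es (∈λ-down p (s≤s z≤n) ℕP.≤-refl (s≤s z≤n) (ℕP.n≤1+n _))
    found : Dec (E∈ (eC r)) → O (ℤ.suc (content r)) ⊎ A (ℤ.suc (content r))
    found (yes ee∈) = inj₂ (eC r , e-rim , content-e r , ee∈ , ¬es)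
    found (no ¬ee)  = inj₁ (eC r , e-rim , content-e r , ¬ee , ¬es)

  -- The next rim cell is `nC r`. The assumption `R (ℤ.suc c)` excludes row 1, where the rim ends: a
  -- rim cell of larger content would put a cell to the east of `r`.
  after-north : ∀ {c} → OnRim (¬_ ∘ E∈) c → R (ℤ.suc c) → I (ℤ.suc c) ⊎ B (ℤ.suc c)
  after-north ((suc zero , j) , (r∈ , ¬es) , refl , ¬e) ((k , l) , (r′∈@(1≤k , _) , _) , eq′) =
    ⊥-elim (¬e (∈λ-down r′∈ (s≤s z≤n) 1≤k (s≤s z≤n) 1+j≤l))
    where
    1+j≤l : suc j ≤ l
    1+j≤l = ℕP.+-cancelʳ-≤ 1 (suc j) l
      (subst (suc j + 1 ≤_) (sym (content-≡⇒ (k , l) (1 , suc j) (trans eq′ (sym (content-e (1 , j)))))) (ℕP.+-monoʳ-≤ (suc j) 1≤k))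
  after-north {c} (r@(suc (suc i) , j) , (r∈@(_ , 1≤j , _) , _) , refl , ¬e) _ = found
    where
    n-rim : IsRim (suc i , j)
    n-rim = ∈λ-down r∈ (s≤s z≤n) (ℕP.n≤1+n _) 1≤j ℕP.≤-refl , ¬e
    found : I (ℤ.suc c) ⊎ B (ℤ.suc c)
    found with (suc i , suc j) ∈λ? λs
    ... | yes e∈ = inj₁ ((suc i , j) , n-rim , content-n r (s≤s z≤n) , e∈ , r∈)
    ... | no ¬e∈ = inj₂ ((suc i , j) , n-rim , content-n r (s≤s z≤n) , ¬e∈ , r∈)

  R-pred : ∀ {a c} → R a → a ℤ.≤ c → R (ℤ.suc c) → R c
  R-pred {a} {c} ((i , j) , (u∈ , _) , refl) a≤c ((k , l) , (r∈ , ¬es) , eq) with (suc k , l) ∈λ? λs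
  ... | yes s∈ = (suc k , l) , (s∈ , λ p → ¬es (∈λ-down p (s≤s z≤n) (ℕP.n≤1+n _) (s≤s z≤n) ℕP.≤-refl)) ,
                 suc-injective (trans (sym (content-n (suc k , l) (s≤s z≤n))) eq)
  R-pred {a} {c} ((i , j) , (u∈ , _) , refl) a≤c ((k , suc (suc l)) , (r∈@(1≤k , _) , ¬es) , eq) | no ¬s =
    (k , suc l) , (∈λ-down r∈ 1≤k ℕP.≤-refl (s≤s z≤n) (ℕP.n≤1+n _) , ¬s) ,
    suc-injective (trans (sym (content-e (k , suc l))) eq)
  -- Here the rim cell is the bottom of the first column. The cell of content `a` would lie in a
  -- strictly lower row, giving a cell to the south after all.
  R-pred {a} {c} ((i , j) , (u∈@(_ , 1≤j , _) , _) , refl) a≤c ((k , suc zero) , (r∈ , ¬es) , eq) | no ¬s =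
    ⊥-elim (¬s (∈λ-down u∈ (s≤s z≤n) k<i (s≤s z≤n) 1≤j))
    where
    j+k<1+i : j + k < 1 + i
    j+k<1+i = content-<⇒ (i , j) (k , 1) (subst (j ⊖ i ℤ.<_) (sym eq) (ℤP.≤-<-trans a≤c (i<suc[i] c)))
    k<i : k < i
    k<i = ℕP.≤-pred (ℕP.≤-trans (s≤s (ℕP.+-monoˡ-≤ k 1≤j)) j+k<1+i)

  R-bounded : ∀ a → Σ ℤ λ d → (a ℤ.≤ d) × ¬ R d
  R-bounded a = a ℤ.⊔ + rowLen λs 1 , ℤP.i≤i⊔j a _ , absurd
    where
    absurd : ¬ R (a ℤ.⊔ + rowLen λs 1)
    absurd ((suc i , j) , (r∈@(_ , 1≤j , _) , _) , eq) = ℤP.<⇒≱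
      (ℤP.<-≤-trans (ℤP.m⊖1+n<m j (suc i)) (ℤ.+≤+ (proj₂ (proj₂ (∈λ-down r∈ (s≤s z≤n) (s≤s z≤n) 1≤j ℕP.≤-refl)))))
      (subst (+ rowLen λs 1 ℤ.≤_) (sym eq) (ℤP.i≤j⊔i a _))

  I-O-disjoint : ∀ {c} → I c → O c → ⊥
  I-O-disjoint = onRim-unique (λ { (e , _) (¬e , _) → ¬e e })

  A-I-disjoint : ∀ {c} → A c → I c → ⊥
  A-I-disjoint = onRim-unique (λ { (_ , ¬s) (_ , s) → ¬s s })

  B-O-disjoint : ∀ {c} → B c → O c → ⊥
  B-O-disjoint = onRim-unique (λ { (_ , s) (_ , ¬s) → ¬s s })

  open Word R I O A B onRim⇒R onRim⇒R onRim⇒R I-O-disjoint A-I-disjoint B-O-disjoint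
    (after-east ∘ onRim-map proj₁) (after-east ∘ onRim-map proj₁)
    (after-north ∘ onRim-map proj₁) (after-north ∘ onRim-map proj₁) R-pred R-bounded

  -- Corner contents and the first content of the rim

  module Outer = Contents λs (outerCorner? λs)
  module Inner = Contents λs (innerCorner? λs)

  outer-rim : ∀ {u} → IsOuterCorner λs u → IsRim u
  outer-rim {u} (u∈@(_ , 1≤j , _) , _ , ¬s) = u∈ , λ es → ¬s (∈λ-down es (s≤s z≤n) ℕP.≤-refl 1≤j (ℕP.n≤1+n _))

  inner-rim : ∀ {u} → IsInnerCorner λs u → IsRim u
  inner-rim {u} (e∈@(1≤i , _) , s∈@(_ , 1≤j , _) , ¬es) = ∈λ-down e∈ 1≤i ℕP.≤-refl 1≤j (ℕP.n≤1+n _) , ¬es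

  ∈outer⇒O : ∀ {c} → c ∈ outerContents λs → O c
  ∈outer⇒O c∈ with Outer.∈contents⁻ c∈
  ... | r , corner@(_ , ¬e , ¬s) , eq = r , outer-rim corner , eq , ¬e , ¬s

  O⇒∈outer : ∀ {c} → O c → c ∈ outerContents λs
  O⇒∈outer (r , rim , refl , ¬e , ¬s) = Outer.∈contents⁺ (proj₁ rim) (proj₁ rim , ¬e , ¬s)

  ∈inner⇒I : ∀ {c} → c ∈ innerContents λs → I c
  ∈inner⇒I c∈ with Inner.∈contents⁻ c∈
  ... | r , corner@(e , s , _) , eq = r , inner-rim corner , eq , e , s

  I⇒∈inner : ∀ {c} → I c → c ∈ innerContents λs
  I⇒∈inner (r , rim , refl , e , s) = Inner.∈contents⁺ (proj₁ rim) (e , s , proj₂ rim)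

  lowest : ℤ
  lowest = content (colLen λs 1 , 1)

  lowest-least : ∀ {c} → R c → lowest ℤ.≤ c
  lowest-least ((i , j) , (r∈@(1≤i , 1≤j , _) , _) , refl) =
    ℤP.≤-trans (ℤP.⊖-monoʳ-≥-≤ 1 (∈λ⇒≤colLen (∈λ-down r∈ 1≤i ℕP.≤-refl (s≤s z≤n) 1≤j)))
               (ℤP.⊖-monoˡ-≤ i 1≤j)

  lowest-OA : ∀ {u} → u ∈λ λs → O lowest ⊎ A lowest
  lowest-OA u∈@(1≤i , 1≤j , _) = found
    where
    r : Cell
    r = colLen λs 1 , 1
    1≤ : 1 ≤ colLen λs 1
    1≤ = ∈λ⇒≤colLen (∈λ-down u∈ (s≤s z≤n) 1≤i (s≤s z≤n) 1≤j)
    ¬s : ¬ S∈ r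
    ¬s s∈ = ℕP.<⇒≱ (∈λ⇒≤colLen s∈) ℕP.≤-refl
    rim : IsRim r
    rim = ≤colLen⇒∈λ 1≤ (s≤s z≤n) ℕP.≤-refl , λ es → ¬s (∈λ-down es (s≤s z≤n) ℕP.≤-refl (s≤s z≤n) (ℕP.n≤1+n _))
    found : O lowest ⊎ A lowest
    found with eC r ∈λ? λs
    ... | yes e = inj₂ (r , rim , refl , e , ¬s)
    ... | no ¬e = inj₁ (r , rim , refl , ¬e , ¬s)

  -- The cell `u` makes the diagram nonempty, so the rim has a first content, of kind O or A.
  corners-interlaced : ∀ {u} → u ∈λ λs → Interlaced lowest (outerContents λs) (innerContents λs)
  corners-interlaced u∈ = interlace _ _ (lowest-OA u∈)
    (Outer.contents-sorted (λ p q → rim-unique (outer-rim p) (outer-rim q)))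
    (Inner.contents-sorted (λ p q → rim-unique (inner-rim p) (inner-rim q)))
    (All.tabulate (lowest-least ∘ onRim⇒R ∘ ∈outer⇒O)) (All.tabulate (lowest-least ∘ onRim⇒R ∘ ∈inner⇒I))
    (All.tabulate ∈outer⇒O) (All.tabulate ∈inner⇒I)
    (λ _ _ → O⇒∈outer) (λ _ _ → I⇒∈inner)

  -- The sets I, O, A, B read off the rim

  inI⇒I : ∀ {u} → inI λs u → I (content u)
  inI⇒I (_ , c∈) = ∈inner⇒I c∈

  inO⇒O : ∀ {u} → inO λs u → O (content u)
  inO⇒O (_ , c∈) = ∈outer⇒O c∈

  inA⇒A : ∀ {u} → inA λs u → A (content u)
  inA⇒A (u∈ , inj₁ c<o) = A-first (corners-interlaced u∈) (lowest-least (rim-exists u∈)) c<o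
  inA⇒A (u∈ , inj₂ k)   = A-index (corners-interlaced u∈) k

  inB⇒B : ∀ {u} → inB λs u → B (content u)
  inB⇒B (u∈ , inj₁ k)   = B-index (corners-interlaced u∈) k
  inB⇒B (u∈ , inj₂ o<c) = B-last (corners-interlaced u∈) (rim-exists u∈) o<c

  -- direction of the rim step that leaves, resp. enters, the diagonal of u
  LeavesEast LeavesNorth EntersEast : Cell → Set
  LeavesEast  u = inI λs u ⊎ inA λs u
  LeavesNorth u = inO λs u ⊎ inB λs u
  EntersEast  u = inO λs u ⊎ inA λs u

  leaves : ∀ {u} → u ∈λ λs → LeavesEast u ⊎ LeavesNorth u
  leaves {u} u∈ with cover (content u) (corners-interlaced u∈) (lowest-least (rim-exists u∈))
  ... | inj₁ i = inj₁ (inj₁ (u∈ , i))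
  ... | inj₂ (inj₁ o) = inj₂ (inj₁ (u∈ , o))
  ... | inj₂ (inj₂ (inj₁ a)) = inj₁ (inj₂ (u∈ , a))
  ... | inj₂ (inj₂ (inj₂ b)) = inj₂ (inj₂ (u∈ , b))

  leavesEast⇒onRim : ∀ {u} → LeavesEast u → OnRim E∈ (content u)
  leavesEast⇒onRim (inj₁ i) = onRim-map proj₁ (inI⇒I i)
  leavesEast⇒onRim (inj₂ a) = onRim-map proj₁ (inA⇒A a)

  leavesNorth⇒onRim : ∀ {u} → LeavesNorth u → OnRim (¬_ ∘ E∈) (content u)
  leavesNorth⇒onRim (inj₁ o) = onRim-map proj₁ (inO⇒O o)
  leavesNorth⇒onRim (inj₂ b) = onRim-map proj₁ (inB⇒B b)

  entersEast⇒onRim : ∀ {u} → EntersEast u → OnRim (¬_ ∘ S∈) (content u)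
  entersEast⇒onRim (inj₁ o) = onRim-map proj₂ (inO⇒O o)
  entersEast⇒onRim (inj₂ a) = onRim-map proj₂ (inA⇒A a)

  leavesEast-leavesNorth : ∀ {u} → LeavesEast u → LeavesNorth u → ⊥
  leavesEast-leavesNorth p q = onRim-unique (λ e ¬e → ¬e e) (leavesEast⇒onRim p) (leavesNorth⇒onRim q)

  leavesEast⇒∈λ : ∀ {u} → LeavesEast u → u ∈λ λs
  leavesEast⇒∈λ (inj₁ (u∈ , _)) = u∈
  leavesEast⇒∈λ (inj₂ (u∈ , _)) = u∈

  -- The rim cell of this diagonal has an east neighbour, and `u` lies weakly north-west of that rim
  -- cell.
  leavesEast⇒e∈λ : ∀ {u} → LeavesEast u → eC u ∈λ λs
  leavesEast⇒e∈λ {u} p =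
    let u∈ = leavesEast⇒∈λ p
        r , rim , eq , e∈ = leavesEast⇒onRim p
        i≤ , j≤ = rim-dominates rim u∈ (sym eq)
    in ∈λ-down e∈ (proj₁ u∈) i≤ (s≤s z≤n) (s≤s j≤)

  next-¬S∈ : ∀ {u c} → LeavesEast u → c ≡ ℤ.suc (content u) → ¬ OnRim S∈ c
  next-¬S∈ p refl south = [ disjoint , disjoint ]′ (after-east (leavesEast⇒onRim p))
    where
    disjoint : ∀ {P : Cell → Set} → ¬ OnRim (λ r → P r × ¬ S∈ r) _
    disjoint = onRim-unique (λ { s (_ , ¬s) → ¬s s }) south

  -- The rim step into the diagonal of `x` goes east, so its rim cell has nothing to the south; this
  -- rules out I and B.
  entersEast-next : ∀ {u x} → LeavesEast u → x ∈λ λs → content x ≡ ℤ.suc (content u) → EntersEast x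
  entersEast-next {u} {x} p x∈ eq with cover (content x) (corners-interlaced x∈) (lowest-least (rim-exists x∈))
  ... | inj₂ (inj₁ o) = inj₁ (x∈ , o)
  ... | inj₂ (inj₂ (inj₁ a)) = inj₂ (x∈ , a)
  ... | inj₁ i = ⊥-elim (next-¬S∈ p eq (onRim-map proj₂ (inI⇒I (x∈ , i))))
  ... | inj₂ (inj₂ (inj₂ b)) = ⊥-elim (next-¬S∈ p eq (onRim-map proj₂ (inB⇒B (x∈ , b))))

-- Candidates and existence of the path Q

module Paths (λs : List ℕ) (part : IsPartition λs) (π : Cell → ℕ) (rpp : IsRPP λs π) where

  open Rim λs part

  -- On λ this is the first row length minus the content. It is the natural number that decreases in
  -- all inductions on growing content.
  coheight : Cell → ℕ
  coheight (i , j) = (rowLen λs 1 ∸ j) + i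

  coheight-< : ∀ {u v} → u ∈λ λs → v ∈λ λs → content u ℤ.< content v → coheight v < coheight u
  coheight-< {u@(i , j)} {v@(k , l)} u∈ v∈ lt = ℕP.+-cancelʳ-< (j + l) (coheight v) (coheight u)
    (subst₂ _<_ v-side u-side (ℕP.+-monoʳ-< m (content-<⇒ u v lt)))
    where
    m = rowLen λs 1
    col≤m : ∀ {i j} → (i , j) ∈λ λs → j ≤ m
    col≤m w∈@(1≤i , 1≤j , _) = proj₂ (proj₂ (∈λ-down w∈ (s≤s z≤n) 1≤i 1≤j ℕP.≤-refl))
    v-side : m + (j + k) ≡ coheight v + (j + l)
    v-side = trans (cong (_+ (j + k)) (sym (ℕP.m∸n+n≡m (col≤m v∈))))
      (solve 4 (λ p l j k → (p :+ l) :+ (j :+ k) := (p :+ k) :+ (j :+ l)) refl (m ∸ l) l j k)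
    u-side : m + (l + i) ≡ coheight u + (j + l)
    u-side = trans (cong (_+ (l + i)) (sym (ℕP.m∸n+n≡m (col≤m u∈))))
      (solve 4 (λ p j l i → (p :+ j) :+ (l :+ i) := (p :+ i) :+ (j :+ l)) refl (m ∸ j) j l i)

  val-∈λ : ∀ u → u ∈λ λs → val π u ≡ π u
  val-∈λ (suc i , suc j) _ = refl

  val-w≤ : ∀ u → u ∈λ λs → val π (wC u) ≤ π u
  val-w≤ (suc i , suc zero)    _  = z≤n
  val-w≤ (suc i , suc (suc j)) u∈ = proj₁ (rpp (suc i , suc j) (∈λ-down u∈ (s≤s z≤n) ℕP.≤-refl (s≤s z≤n) (ℕP.n≤1+n _))) u∈

  val-n≤ : ∀ u → u ∈λ λs → val π (nC u) ≤ π u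
  val-n≤ (suc zero    , suc j) _  = z≤n
  val-n≤ (suc (suc i) , suc j) u∈ = proj₂ (rpp (suc i , suc j) (∈λ-down u∈ (s≤s z≤n) (ℕP.n≤1+n _) (s≤s z≤n) ℕP.≤-refl)) u∈

  val-nw≤w : ∀ u → u ∈λ λs → val π (nC (wC u)) ≤ val π (wC u)
  val-nw≤w (suc zero    , suc zero)    _  = z≤n
  val-nw≤w (suc (suc i) , suc zero)    _  = z≤n
  val-nw≤w (suc i       , suc (suc j)) u∈ =
    val-n≤ (suc i , suc j) (∈λ-down u∈ (s≤s z≤n) ℕP.≤-refl (s≤s z≤n) (ℕP.n≤1+n _))

  n∈λ : ∀ u → u ∈λ λs → 0 < val π (nC u) → nC u ∈λ λs
  n∈λ (suc (suc i) , suc j) u∈ _ = ∈λ-down u∈ (s≤s z≤n) (ℕP.n≤1+n _) (s≤s z≤n) ℕP.≤-refl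

  content<e : ∀ u → content u ℤ.< content (eC u)
  content<e u = subst (content u ℤ.<_) (sym (content-e u)) (i<suc[i] _)

  content<n : ∀ u → u ∈λ λs → content u ℤ.< content (nC u)
  content<n u (1≤i , _) = subst (content u ℤ.<_) (sym (content-n u 1≤i)) (i<suc[i] _)

  cand⇒∈λ : ∀ {v} → IsCand λs π v → v ∈λ λs
  cand⇒∈λ (inj₁ ((v∈ , _) , _)) = v∈
  cand⇒∈λ (inj₂ ((v∈ , _) , _)) = v∈

  cand⇒w< : ∀ {v} → IsCand λs π v → val π (wC v) < π v
  cand⇒w< (inj₁ (_ , w<)) = w<
  cand⇒w< (inj₂ (_ , w< , _)) = w<

  cand⇒entersEast : ∀ {v} → IsCand λs π v → EntersEast v
  cand⇒entersEast (inj₁ (o , _)) = inj₁ o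
  cand⇒entersEast (inj₂ (a , _)) = inj₂ a

  -- If `x` is not yet a candidate, it lies in A and π(n x) = π(x). Then n x is in λ because the
  -- value is positive, its diagonal is again entered from the west, and π(w n x) ≤ π(w x) < π(x) =
  -- π(n x), so the search goes on one row higher.
  climb : ∀ i j → (i , j) ∈λ λs → EntersEast (i , j) → val π (wC (i , j)) < π (i , j) →
    Σ Cell λ v → IsCand λs π v × content (i , j) ℤ.≤ content v
  climb i j x∈ (inj₁ o) w< = (i , j) , inj₁ (o , w<) , ℤP.≤-refl
  climb (suc i) j x∈ (inj₂ a) w< with val π (i , j) <? π (suc i , j)
  climb (suc i) j x∈ (inj₂ a) w< | yes n< = (suc i , j) , inj₂ (a , w< , n<) , ℤP.≤-refl
  climb (suc zero) j x∈ (inj₂ a) w< | no n≮ = ⊥-elim (n≮ (ℕP.≤-<-trans z≤n w<))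
  climb (suc (suc i)) (suc j) x∈ (inj₂ a) w< | no n≮ =
    let x  = suc (suc i) , suc j
        n∈ = n∈λ x x∈ (ℕP.<-≤-trans (ℕP.≤-<-trans z≤n w<) (ℕP.≮⇒≥ n≮))
        v , cand , le = climb (suc i) (suc j) n∈ (entersEast-next (inj₂ a) n∈ (content-n x (s≤s z≤n)))
          (ℕP.≤-<-trans (val-nw≤w x x∈) (ℕP.<-≤-trans w< (ℕP.≮⇒≥ n≮)))
    in v , cand , ℤP.≤-trans (ℤP.<⇒≤ (content<n x x∈)) le

  -- Every step raises the content, so `n` is enough fuel. The value stays positive along the path,
  -- so a north step never reaches row 0, where `val` is 0.
  QPath-exists : ∀ n u → coheight u < n → u ∈λ λs → 0 < π u → Σ Cell λ ω → Σ ℕ λ s → QPath λs π u ω s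
  QPath-exists (suc n) u (s≤s le) u∈ 0<π = go (leaves u∈)
    where
    east : eC u ∈λ λs → Σ Cell λ ω → Σ ℕ λ s → QPath λs π (eC u) ω s
    east e∈ = QPath-exists n (eC u) (ℕP.<-≤-trans (coheight-< u∈ e∈ (content<e u)) le) e∈
      (ℕP.<-≤-trans 0<π (proj₁ (rpp u u∈) e∈))
    go : LeavesEast u ⊎ LeavesNorth u → Σ Cell λ ω → Σ ℕ λ s → QPath λs π u ω s
    go (inj₁ le) = let ω , s , q = east (leavesEast⇒e∈λ le) in ω , suc s , eastIA u∈ le q
    go (inj₂ ln) with val π (nC u) <? π u | eC u ∈λ? λs
    ... | yes n< | yes e∈ = let ω , s , q = east e∈ in ω , suc s , eastGt u∈ e∈ n< q
    ... | yes n< | no ¬e  = u , 0 , stop u∈ n< ¬e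
    ... | no n≮  | _      =
      let eq = ℕP.≤-antisym (ℕP.≮⇒≥ n≮) (val-n≤ u u∈)
          n∈ = n∈λ u u∈ (subst (0 <_) eq 0<π)
          ω , s , q = QPath-exists n (nC u) (ℕP.<-≤-trans (coheight-< u∈ n∈ (content<n u u∈)) le) n∈
                        (subst (0 <_) (trans eq (val-∈λ (nC u) n∈)) 0<π)
      in ω , suc s , north u∈ ln eq q

  QPath-start∈λ : ∀ {u ω s} → QPath λs π u ω s → u ∈λ λs
  QPath-start∈λ (stop u∈ _ _)     = u∈
  QPath-start∈λ (north u∈ _ _ _)  = u∈
  QPath-start∈λ (eastIA u∈ _ _)   = u∈
  QPath-start∈λ (eastGt u∈ _ _ _) = u∈

  QPath-end : ∀ {u ω s} → QPath λs π u ω s → (ω ∈λ λs) × ¬ (eC ω ∈λ λs)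
  QPath-end (stop u∈ _ ¬e)   = u∈ , ¬e
  QPath-end (north _ _ _ q)  = QPath-end q
  QPath-end (eastIA _ _ q)   = QPath-end q
  QPath-end (eastGt _ _ _ q) = QPath-end q

  -- Each step raises the content by one; the equation is c(ω) = c(u) + s cleared of subtractions.
  QPath-content : ∀ {u ω s} → QPath λs π u ω s → proj₂ ω + proj₁ u ≡ s + (proj₂ u + proj₁ ω)
  QPath-content (stop _ _ _) = refl
  QPath-content {suc i , j} {k , l} (north _ _ _ q) = trans (ℕP.+-suc l i) (cong suc (QPath-content q))
  QPath-content {i , j} {k , l} (eastIA {s = s} _ _ q) = trans (QPath-content q) (ℕP.+-suc s (j + k))
  QPath-content {i , j} {k , l} (eastGt {s = s} _ _ _ q) = trans (QPath-content q) (ℕP.+-suc s (j + k))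

  -- The reversed path as a removable path

  SWPath-bounds : ∀ {y ps u} → SWPath λs (y ∷ ps) → u ∈ y ∷ ps → (proj₁ y ≤ proj₁ u) × (proj₂ u ≤ proj₂ y)
  SWPath-bounds _ (here refl) = ℕP.≤-refl , ℕP.≤-refl
  SWPath-bounds (step _ (inj₁ refl) p) (there u∈) =
    let i≤ , j≤ = SWPath-bounds p u∈ in ℕP.<⇒≤ i≤ , j≤
  SWPath-bounds (step _ (inj₂ refl) p) (there u∈) =
    let i≤ , j≤ = SWPath-bounds p u∈ in i≤ , ℕP.≤-trans j≤ (ℕP.m∸n≤m _ 1)

  -- ps is the part of Q(v, π) before the current cell y, backwards; the conditions that depend
  -- on the next step are not yet required at y.
  record Trail (y : Cell) (ps : List Cell) : Set where
    field
      path     : SWPath λs (y ∷ ps)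
      corner   : val π (nC (wC y)) < π y
      positive : ∀ u → u ∈ y ∷ ps → 1 ≤ π u
      east     : ∀ u → u ∈ ps → LeavesEast u → (eC u ∈ y ∷ ps) × (π u ≡ π (eC u))
      south    : ∀ u → u ∈ y ∷ ps → sC u ∈ y ∷ ps → π u ≡ π (sC u)
      west<    : ∀ u → u ∈ y ∷ ps → wC u ∈ y ∷ ps ⊎ val π (wC u) < π u
      north<   : ∀ u → u ∈ ps → nC u ∈ y ∷ ps ⊎ val π (nC u) < π u

  open Trail

  trail-start : ∀ {v} → IsCand λs π v → Trail v []
  trail-start {v} cand = record
    { path     = single v∈
    ; corner   = ℕP.≤-<-trans (val-nw≤w v v∈) w<
    ; positive = λ { _ (here refl) → ℕP.≤-<-trans z≤n w< }
    ; east     = λ _ ()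
    ; south    = λ { _ (here refl) (here eq) → ⊥-elim (ℕP.1+n≢n (cong proj₁ eq)) }
    ; west<    = λ { _ (here refl) → inj₂ w< }
    ; north<   = λ _ ()
    }
    where
    v∈ = cand⇒∈λ cand
    w< = cand⇒w< cand

  -- As w n y = n w y, the `corner` inequality at `y` becomes the strict west inequality at n y, and
  -- this in turn gives `corner` there.
  trail-north : ∀ {y ps} → Trail y ps → LeavesNorth y → π y ≡ val π (nC y) → nC y ∈λ λs → Trail (nC y) (y ∷ ps)
  trail-north {y@(suc i , j)} {ps} t ln eq n∈ = record
    { path     = step n∈ (inj₁ refl) (path t)
    ; corner   = ℕP.≤-<-trans (val-nw≤w (nC y) n∈) w<
    ; positive = λ { _ (here refl) → subst (1 ≤_) πy≡ (positive t y (here refl)) ; u (there u∈) → positive t u u∈ }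
    ; east     = λ { _ (here refl) le → ⊥-elim (leavesEast-leavesNorth le ln)
                   ; u (there u∈) le → let e∈ , eq = east t u u∈ le in there e∈ , eq }
    ; south    = south′
    ; west<    = λ { _ (here refl) → inj₂ w< ; u (there u∈) → Sum.map₁ there (west< t u u∈) }
    ; north<   = λ { _ (here refl) → inj₁ (here refl) ; u (there u∈) → Sum.map₁ there (north< t u u∈) }
    }
    where
    πy≡ : π y ≡ π (nC y)
    πy≡ = trans eq (val-∈λ (nC y) n∈)
    w< : val π (wC (nC y)) < π (nC y)
    w< = subst (val π (wC (nC y)) <_) πy≡ (corner t)
    south′ : ∀ u → u ∈ nC y ∷ y ∷ ps → sC u ∈ nC y ∷ y ∷ ps → π u ≡ π (sC u)
    south′ _ (here refl) _ = sym πy≡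
    south′ u (there u∈) (there s∈) = south t u u∈ s∈
    -- Such a `u` would lie above n y, but no earlier cell lies above `y`.
    south′ u (there u∈) (here refl) = ⊥-elim (ℕP.<⇒≱ (ℕP.n<1+n _) (ℕP.<⇒≤ (proj₁ (SWPath-bounds (path t) u∈))))

  -- As n w e y = n y, the inequality π(n y) < π(y) yields `corner` at e y. Earlier cells are weakly
  -- west of `y`, so no vertical pair involves the new cell.
  trail-east : ∀ {y ps} → Trail y ps → eC y ∈λ λs → val π (nC y) < π y → (LeavesEast y → π y ≡ π (eC y)) →
    Trail (eC y) (y ∷ ps)
  trail-east {y@(i , j)} {ps} t e∈ n< east≡ = record
    { path     = step e∈ (inj₂ refl) (path t)
    ; corner   = ℕP.<-≤-trans n< πy≤
    ; positive = λ { _ (here refl) → ℕP.≤-trans (positive t y (here refl)) πy≤ ; u (there u∈) → positive t u u∈ }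
    ; east     = λ { _ (here refl) le → here refl , east≡ le
                   ; u (there u∈) le → let e∈ , eq = east t u u∈ le in there e∈ , eq }
    ; south    = south′
    ; west<    = λ { _ (here refl) → inj₁ (there (here refl)) ; u (there u∈) → Sum.map₁ there (west< t u u∈) }
    ; north<   = λ { _ (here refl) → inj₂ n< ; u (there u∈) → Sum.map₁ there (north< t u u∈) }
    }
    where
    y∈ : y ∈λ λs
    y∈ with path t
    ... | single y∈   = y∈
    ... | step y∈ _ _ = y∈
    πy≤ : π y ≤ π (eC y)
    πy≤ = proj₁ (rpp y y∈) e∈
    too-east : ∀ {k} → (k , suc j) ∈ y ∷ ps → ⊥
    too-east u∈ = ℕP.<⇒≱ (ℕP.n<1+n j) (proj₂ (SWPath-bounds (path t) u∈))
    south′ : ∀ u → u ∈ eC y ∷ y ∷ ps → sC u ∈ eC y ∷ y ∷ ps → π u ≡ π (sC u)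
    south′ _ (here refl) (here eq)  = ⊥-elim (ℕP.1+n≢n (cong proj₁ eq))
    south′ _ (here refl) (there s∈) = ⊥-elim (too-east s∈)
    south′ u (there u∈) (there s∈) = south t u u∈ s∈
    south′ (k , l) (there u∈) (here eq) = ⊥-elim (too-east (subst (λ x → (k , x) ∈ y ∷ ps) (cong proj₂ eq) u∈))

  -- Order can fail only when `v` is lowered and `u` is not, and then a strict inequality absorbs
  -- the loss. The fields `west<` and `north<` of `Trail` provide exactly this alternative.
  minusP-mono : ∀ P u v → u ∈λ λs → π u ≤ π v → (v ∈ P → u ∈ P ⊎ val π u < π v) → minusP P π u ≤ minusP P π v
  minusP-mono P u v u∈ le strict with mem? cellDec u P | mem? cellDec v P
  ... | yes _  | yes _  = ℕP.∸-monoˡ-≤ 1 le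
  ... | yes _  | no _   = ℕP.≤-trans (ℕP.m∸n≤m _ 1) le
  ... | no _   | no _   = le
  ... | no u∉P | yes v∈P with strict v∈P
  ...   | inj₁ u∈P = ⊥-elim (u∉P u∈P)
  ...   | inj₂ lt  = ℕP.∸-monoˡ-≤ 1 (subst (_< π v) (val-∈λ u u∈) lt)

  Removable : List Cell → Set
  Removable P = Compatible λs P π × MinusIsRPP λs P π

  trail-end : ∀ {y ps} → Trail y ps → val π (nC y) < π y → ¬ (eC y ∈λ λs) → Removable (y ∷ ps)
  trail-end {y} {ps} t n< ¬e = (east′ , south t) , positive t , λ u u∈ →
      (λ e∈ → minusP-mono P u (eC u) u∈ (proj₁ (rpp u u∈) e∈) (west< t (eC u)))
    , (λ s∈ → minusP-mono P u (sC u) u∈ (proj₂ (rpp u u∈) s∈) (north′ (sC u)))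
    where
    P = y ∷ ps
    east′ : ∀ u → u ∈ P → LeavesEast u → (eC u ∈ P) × (π u ≡ π (eC u))
    -- The last cell has no east neighbour, so its diagonal is not east-leaving and compatibility
    -- asks nothing of it.
    east′ _ (here refl) le = ⊥-elim (¬e (leavesEast⇒e∈λ le))
    east′ u (there u∈)  le = east t u u∈ le
    north′ : ∀ u → u ∈ P → nC u ∈ P ⊎ val π (nC u) < π u
    north′ _ (here refl) = inj₂ n<
    north′ u (there u∈)  = north< t u u∈

  -- Following Q to a factor or to a later candidate

  LaterCand : Cell → Set
  LaterCand y = Σ Cell λ v → IsCand λs π v × content y ℤ.< content v

  RemovablePath : Cell → ℕ → Set
  RemovablePath ω n = Σ (List Cell) λ qs → SWPath λs (ω ∷ qs) × (length qs ≡ n) × Removable (ω ∷ qs)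

  later : ∀ y z → content y ℤ.< content z → LaterCand z → LaterCand y
  later _ _ y<z (v , cand , z<v) = v , cand , ℤP.<-trans y<z z<v

  climb-later : ∀ y x → content y ℤ.< content x → x ∈λ λs → EntersEast x → val π (wC x) < π x → LaterCand y
  climb-later _ x y<x x∈ ee w< = let v , cand , le = climb _ _ x∈ ee w< in v , cand , ℤP.<-≤-trans y<x le

  mutual
    walk : ∀ {y ω s ps} → QPath λs π y ω s → Trail y ps → LaterCand y ⊎ RemovablePath ω (s + length ps)
    walk (stop _ n< ¬e) t = inj₂ (_ , path t , refl , trail-end t n< ¬e)
    walk {y} {ω} {suc s} {ps} (north y∈ ln eq q) t =
      Sum.map (later y (nC y) (content<n y y∈)) (subst (RemovablePath ω) (ℕP.+-suc s (length ps)))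
        (walk q (trail-north t ln eq (QPath-start∈λ q)))
    walk {y} (eastIA y∈ le q) t with val π (nC y) <? π y
    ... | yes n< = walk-east y∈ n< q t
    ... | no n≮  =
      let n∈ = n∈λ y y∈ (ℕP.<-≤-trans (positive t y (here refl)) (ℕP.≮⇒≥ n≮))
      -- On I ∪ A the path goes east even if π(n y) = π(y). In that case π(w n y) = π(n w y) < π(y)
      -- = π(n y) by `corner`, so one climbs from n y.
      in inj₁ (climb-later y (nC y) (content<n y y∈) n∈ (entersEast-next le n∈ (content-n y (proj₁ y∈)))
           (ℕP.<-≤-trans (corner t) (subst (π y ≤_) (val-∈λ (nC y) n∈) (ℕP.≮⇒≥ n≮))))
    walk (eastGt y∈ _ n< q) t = walk-east y∈ n< q t

    walk-east : ∀ {y ω s ps} → y ∈λ λs → val π (nC y) < π y → QPath λs π (eC y) ω s → Trail y ps →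
      LaterCand y ⊎ RemovablePath ω (suc s + length ps)
    walk-east {y} {ω} {s} {ps} y∈ n< q t = go (leaves y∈)
      where
      e∈ : eC y ∈λ λs
      e∈ = QPath-start∈λ q
      continue : (LeavesEast y → π y ≡ π (eC y)) → LaterCand y ⊎ RemovablePath ω (suc s + length ps)
      continue east≡ = Sum.map (later y (eC y) (content<e y)) (subst (RemovablePath ω) (ℕP.+-suc s (length ps)))
        (walk q (trail-east t e∈ n< east≡))
      go : LeavesEast y ⊎ LeavesNorth y → LaterCand y ⊎ RemovablePath ω (suc s + length ps)
      go (inj₂ ln) = continue (λ le → ⊥-elim (leavesEast-leavesNorth le ln))
      go (inj₁ le) with π y <? π (eC y)
      -- Compatibility would need equality here. The strict inequality says instead that e y exceeds
      -- its west neighbour, so one climbs from e y.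
      ... | yes e< = inj₁ (climb-later y (eC y) (content<e y) e∈ (entersEast-next le e∈ (content-e y))
                       (subst (_< π (eC y)) (sym (val-∈λ y y∈)) e<))
      ... | no e≮  = continue (λ _ → ℕP.≤-antisym (proj₁ (rpp y y∈) e∈) (ℕP.≮⇒≥ e≮))

  -- Rim-hooks and the induction on content

  Foot : Cell → Cell → Set
  Foot v r = IsRim r × content r ≡ content v × ¬ S∈ r

  -- A foot is the bottom of its column. If r′ were not in a later column it would lie at least as
  -- low as r, and its content could not be larger.
  foot-< : ∀ {v r v′ r′} → Foot v r → Foot v′ r′ → content v ℤ.< content v′ → proj₂ r < proj₂ r′
  foot-< {r = r@(a , b)} {r′ = r′@(a′ , b′)} ((r∈ , _) , eq , _) (((_ , 1≤b′ , _) , _) , eq′ , ¬s′) lt =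
    ℕP.≰⇒> λ b′≤b → ℕP.<⇒≱ (content-<⇒ r r′ (subst₂ ℤ._<_ (sym eq) (sym eq′) lt))
      (ℕP.+-mono-≤ b′≤b (ℕP.≮⇒≥ λ a′<a → ¬s′ (∈λ-down r∈ (s≤s z≤n) a′<a 1≤b′ b′≤b)))

  record HookCell (ω : Cell) (s : ℕ) (w : Cell) : Set where
    field
      w∈   : w ∈λ λs
      tail : hookTail λs w ≡ ω
      len  : hookLen λs w ≡ s

  -- The foot has the content of `v`, so it is the head of the rim-hook with the tail and length of
  -- Q(v, π). The row of ω and the column of the foot therefore index that hook.
  hookCell : ∀ {v ω s r} → QPath λs π v ω s → Foot v r → HookCell ω s (proj₁ ω , proj₂ r)
  hookCell {v@(i , j)} {ω@(k , l)} {s} {r@(a , b)} q ((r∈@(1≤a , 1≤b , _) , _) , eq , ¬s) =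
    record { w∈ = 1≤k , 1≤b , subst (b ≤_) (sym row≡) b≤l ; tail = cong (k ,_) row≡ ; len = len≡ }
    where
    ω∈ = proj₁ (QPath-end q)
    1≤k = proj₁ ω∈
    row≡ : rowLen λs k ≡ l
    row≡ = ℕP.≤-antisym (ℕP.≮⇒≥ λ l< → proj₂ (QPath-end q) (1≤k , s≤s z≤n , l<)) (proj₂ (proj₂ ω∈))
    col≡ : colLen λs b ≡ a
    col≡ = ℕP.≤-antisym (ℕP.≮⇒≥ λ a< → ¬s (≤colLen⇒∈λ (s≤s z≤n) 1≤b a<)) (∈λ⇒≤colLen r∈)
    -- The content of ω exceeds that of the foot by `s`. With `b≤l` and `k≤a` the truncated
    -- differences in `hookLen` are exact and add up to `s`.
    balance : l + a ≡ s + (b + k)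
    balance = ℕP.+-cancelʳ-≡ i (l + a) (s + (b + k))
      (trans (solve 3 (λ l a i → (l :+ a) :+ i := (l :+ i) :+ a) refl l a i)
      (trans (cong (_+ a) (QPath-content q))
      (trans (solve 4 (λ s j k a → (s :+ (j :+ k)) :+ a := (s :+ k) :+ (j :+ a)) refl s j k a)
      (trans (cong (λ x → (s + k) + x) (sym (content-≡⇒ r v eq)))
             (solve 4 (λ s k b i → (s :+ k) :+ (b :+ i) := (s :+ (b :+ k)) :+ i) refl s k b i)))))
    b+k≤l+a : b + k ≤ l + a
    b+k≤l+a = subst (b + k ≤_) (sym balance) (ℕP.m≤n+m (b + k) s)
    k≤a : k ≤ a
    -- Otherwise `balance` forces b ≤ l, and ω would put the cell below the foot into λ.
    k≤a = ℕP.≮⇒≥ λ a<k → ¬s (∈λ-down ω∈ (s≤s z≤n) a<k 1≤b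
      (ℕP.+-cancelʳ-≤ k b l (ℕP.≤-trans b+k≤l+a (ℕP.+-monoʳ-≤ l (ℕP.<⇒≤ a<k)))))
    b≤l : b ≤ l
    b≤l = subst (b ≤_) row≡ (proj₂ (proj₂ (∈λ-down r∈ 1≤k k≤a 1≤b ℕP.≤-refl)))
    len≡ : (rowLen λs k ∸ b) + (colLen λs b ∸ k) ≡ s
    len≡ = trans (cong₂ (λ x y → (x ∸ b) + (y ∸ k)) row≡ col≡)
      (ℕP.+-cancelʳ-≡ (b + k) _ s
        (trans (solve 4 (λ x y b k → (x :+ y) :+ (b :+ k) := (x :+ b) :+ (y :+ k)) refl (l ∸ b) (a ∸ k) b k)
        (trans (cong₂ _+_ (ℕP.m∸n+n≡m b≤l) (ℕP.m∸n+n≡m k≤a)) balance)))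

  open HookCell

  QPath-of : ∀ {v} → IsCand λs π v → Σ Cell λ ω → Σ ℕ λ s → QPath λs π v ω s
  QPath-of {v} cand = QPath-exists _ v ℕP.≤-refl (cand⇒∈λ cand) (ℕP.≤-<-trans z≤n (cand⇒w< cand))

  foot-of : ∀ {v} → IsCand λs π v → Σ Cell (Foot v)
  foot-of cand = entersEast⇒onRim (cand⇒entersEast cand)

  factor-below : ∀ n {v ω s r} → coheight v < n → IsCand λs π v → QPath λs π v ω s → Foot v r →
    Σ Cell λ h → (h ∈λ λs) × IsFactor λs π h × (h ≤rl (proj₁ ω , proj₂ r))
  factor-below (suc n) {v} {ω} {s} {r} (s≤s le) cand q foot with walk q (trail-start cand)
  ... | inj₂ (qs , sw , len-qs , compat , minus) =
    let hc = hookCell q foot in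
    (proj₁ ω , proj₂ r) , w∈ hc ,
    (ω , qs , sw , sym (tail hc) , trans len-qs (trans (ℕP.+-identityʳ s) (sym (len hc))) , compat , minus) ,
    inj₂ (refl , ℕP.≤-refl)
  ... | inj₁ (v′ , cand′ , v<v′) =
    let r′ , foot′ = foot-of cand′
        _ , _ , q′ = QPath-of cand′
        h , h∈ , fac , h≤ = factor-below n (ℕP.<-≤-trans (coheight-< (cand⇒∈λ cand) (cand⇒∈λ cand′) v<v′) le) cand′ q′ foot′
        r<r′ = foot-< {v} {r} {v′} {r′} foot foot′ v<v′
    -- The foot of the later candidate is in a strictly later column, which alone decides the
    -- reverse lexicographic order.
    in h , h∈ , fac , inj₁ ([ ℕP.<-trans r<r′ , (λ { (eq , _) → subst (proj₂ r <_) (sym eq) r<r′ }) ]′ h≤)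

mainTheorem8 : (λs : List ℕ) → IsPartition λs → (π : Cell → ℕ) → IsRPP λs π →
    (u : Cell) → IsCand λs π u →
    Σ Cell λ ω → Σ ℕ λ s → QPath λs π u ω s ×
    Σ Cell λ w → (w ∈λ λs) × (hookTail λs w ≡ ω) × (hookLen λs w ≡ s) ×
    Σ Cell λ h → (h ∈λ λs) × IsFactor λs π h × (h ≤rl w)
mainTheorem8 λs part π rpp u cand =
  let ω , s , q = QPath-of cand
      r , foot = foot-of cand
      hc = hookCell q foot
  in ω , s , q , (proj₁ ω , proj₂ r) , w∈ hc , tail hc , len hc , factor-below _ ℕP.≤-refl cand q foot
  where
  open Paths λs part π rpp
  open HookCell
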